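{- Every strongly regular graph with at least six vertices is $2$-reconstructible; that is, if $G$ is a strongly regular graph with $n\ge 6$ vertices, then every graph $H$ with $n$ vertices having the same $(n-2)$-deck as $G$ is isomorphic to $G$.
   Context: All graphs are finite, simple (no loops or multiple edges). For an $n$-vertex graph $G$ and $1\le k\le n$, the $k$-deck of $G$ is the multiset of isomorphism classes of the $\binom{n}{k}$ induced subgraphs of $G$ on $k$ vertices (one for each $k$-subset of $V(G)$). A graph is $\ell$-reconstructible if it is determined up to isomorphism by its $(n-\ell)$-deck, i.e., every $n$-vertex graph with the same $(n-\ell)$-deck is isomorphic to it. A graph is strongly regular with parameters $(k,\lambda,\mu)$ if it is $k$-regular, every two adjacent vertices have exactly $\lambda$ common neighbors, and every two distinct nonadjacent vertices have exactly $\mu$ common neighbors. -}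

module Defs where

open import Data.Bool using (Bool; true; false)
open import Data.Nat using (ℕ; _∸_)
open import Data.Fin using (Fin)
open import Data.Fin.Subset using (Subset; _∈_; _∩_; ∣_∣)
open import Data.Vec using (tabulate)
open import Data.Product using (Σ; ∃; _×_; _,_; proj₁)
open import Function.Bundles using (_↔_; Inverse)
open import Relation.Binary.PropositionalEquality using (_≡_; _≢_)
open import Relation.Nullary using (¬_)

record Graph (n : ℕ) : Set where
  field
    adj   : Fin n → Fin n → Bool
    sym   : ∀ u v → adj u v ≡ adj v u
    irref : ∀ v → adj v v ≡ false
open Graph public

_≅_ : ∀ {n} → Graph n → Graph n → Set
_≅_ {n} G H = Σ (Fin n ↔ Fin n) λ f →
  ∀ u v → adj H (Inverse.to f u) (Inverse.to f v) ≡ adj G u v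

KSubset : ℕ → ℕ → Set
KSubset n k = Σ (Subset n) λ S → ∣ S ∣ ≡ k

InducedIso : ∀ {n} → Graph n → Subset n → Graph n → Subset n → Set
InducedIso {n} G S H T = Σ (Fin n → Fin n) λ f →
    (∀ x → x ∈ S → f x ∈ T)
  × (∀ x y → x ∈ S → y ∈ S → f x ≡ f y → x ≡ y)
  × (∀ y → y ∈ T → ∃ λ x → x ∈ S × f x ≡ y)
  × (∀ x y → x ∈ S → y ∈ S → adj H (f x) (f y) ≡ adj G x y)

-- G and H have the same k-deck: the multisets of isomorphism classes of
-- induced k-vertex subgraphs coincide, i.e. there is a bijection between
-- the k-subsets of V(G) and of V(H) matching induced subgraphs up to
-- isomorphism.
SameDeck : ∀ {n} → ℕ → Graph n → Graph n → Set
SameDeck {n} k G H = Σ (KSubset n k ↔ KSubset n k) λ σ →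
  ∀ (S : KSubset n k) →
    InducedIso G (proj₁ S) H (proj₁ (Inverse.to σ S))

Reconstructible : ∀ {n} → ℕ → Graph n → Set
Reconstructible {n} ℓ G = ∀ (H : Graph n) → SameDeck (n ∸ ℓ) G H → H ≅ G

N : ∀ {n} → Graph n → Fin n → Subset n
N G v = tabulate (adj G v)

StronglyRegularWith : ∀ {n} → Graph n → ℕ → ℕ → ℕ → Set
StronglyRegularWith {n} G k l m =
    (∀ v → ∣ N G v ∣ ≡ k)
  × (∀ u v → adj G u v ≡ true → ∣ N G u ∩ N G v ∣ ≡ l)
  × (∀ u v → u ≢ v → adj G u v ≡ false → ∣ N G u ∩ N G v ∣ ≡ m)

StronglyRegular : ∀ {n} → Graph n → Set
StronglyRegular G = Σ ℕ λ k → Σ ℕ λ l → Σ ℕ λ m → StronglyRegularWith G k l m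

{-# OPTIONS --safe #-}

-- The deck determines the numbers of edges and of (not necessarily induced) two-edge paths, hence
-- Σ deg and Σ deg²; since G is regular, the degrees of H have variance zero and H is regular too.
-- In a k-regular graph the card missing u and v shows how many of u, v each remaining vertex x is
-- adjacent to (k minus its degree in the card), and hence whether u and v are adjacent and how many
-- common neighbours they have. So H is strongly regular with the parameters of G. Finally, one card
-- suffices: for remaining x ≠ y, the number of common neighbours of x and y lost from the card is
-- the inner product of the 0/1-vectors recording adjacency to (u , v), and these inner products
-- determine the vectors up to exchanging u and v.
module Submission where

open import Defs
open import Data.Bool using (Bool; true; false; if_then_else_)
open import Data.Bool.Properties using (not-involutive) renaming (_≟_ to _≟ᵇ_)
open import Data.Fin as Fin using (Fin; zero; suc)
open import Data.Fin.Permutation using (transpose)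
open import Data.Fin.Properties as Finₚ using (_≟_)
open import Data.Fin.Subset using (Subset; inside; outside; _∈_; _∩_; _∪_; ∁; ⊥; ⁅_⁆; ∣_∣)
open import Data.Fin.Subset.Properties
  using (x∉p⇒x∈∁p; x∈∁p⇒x∉p; x∈p∪q⁻; x∈p∪q⁺; x∈⁅x⁆; x∈⁅y⁆⇒x≡y; ∣⁅x⁆∣≡1; ∣∁p∣≡n∸∣p∣; ∪-identityˡ; ∪-identityʳ)
open import Data.Nat using (ℕ; zero; suc; _+_; _*_; _∸_; _≤_; z≤n; s≤s; ∣_-_∣)
open import Data.Nat.Properties hiding (_≟_)
open import Data.Nat.Tactic.RingSolver using (solve-∀)
open import Data.Product using (Σ; ∃; _×_; _,_; proj₁; proj₂; uncurry)
open import Data.Sum using (_⊎_; inj₁; inj₂)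
open import Data.Vec using (tabulate; []; _∷_)
open import Function using (_∘_)
open import Function.Bundles using (_↔_; Inverse; mk↔ₛ′)
open import Function.Properties.Inverse using (↔-sym; ↔-trans)
open import Relation.Binary.Definitions using (tri<; tri≈; tri>)
open import Relation.Binary.PropositionalEquality as ≡
  using (_≡_; _≢_; refl; cong; cong₂; trans; subst; module ≡-Reasoning)
open import Relation.Nullary using (¬_; ¬?; _×-dec_; does; yes; no; contradiction)
open import Relation.Nullary.Decidable using (dec-true; dec-false)

open import Algebra.Properties.Semiring.Sum +-*-semiring
  using (sum; sum-cong-≗; sum-replicate-zero; ∑-distrib-+; ∑-comm; *-distribˡ-sum; *-distribʳ-sum; sum-permute)

private variable
  n : ℕ

-- Indicators of equality and inequality of vertices.

δ δ̄ : Fin n → Fin n → ℕ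
δ i j = if does (i ≟ j) then 1 else 0
δ̄ i j = if does (i ≟ j) then 0 else 1

δ̄-refl : (i : Fin n) → δ̄ i i ≡ 0
δ̄-refl i rewrite dec-true (i ≟ i) refl = refl

δ̄-≢ : {i j : Fin n} → i ≢ j → δ̄ i j ≡ 1
δ̄-≢ {i = i} {j} i≢j rewrite dec-false (i ≟ j) i≢j = refl

δ+δ̄ : (i j : Fin n) → δ i j + δ̄ i j ≡ 1
δ+δ̄ i j with does (i ≟ j)
... | true  = refl
... | false = refl

δ̄-sym : (i j : Fin n) → δ̄ i j ≡ δ̄ j i
δ̄-sym i j with i ≟ j
... | yes refl = ≡.sym (δ̄-refl i)
... | no  i≢j  = ≡.sym (δ̄-≢ (i≢j ∘ ≡.sym))

δ̄-cong : ∀ {m} {i j : Fin n} {k l : Fin m} →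
         (i ≡ j → k ≡ l) → (k ≡ l → i ≡ j) → δ̄ i j ≡ δ̄ k l
δ̄-cong {i = i} {j} {k} {l} f g with i ≟ j | k ≟ l
... | yes _   | yes _   = refl
... | no _    | no _    = refl
... | yes i≡j | no k≢l  = contradiction (f i≡j) k≢l
... | no i≢j  | yes k≡l = contradiction (g k≡l) i≢j

-- The factor `δ̄ i j` vanishes when `i ≡ j`, so a summand may be rewritten under the assumption
-- `i ≢ j`. Such guards replace sums over subtypes.
δ̄-guard : (i j : Fin n) {a b : ℕ} → (i ≢ j → a ≡ b) → δ̄ i j * a ≡ δ̄ i j * b
δ̄-guard i j a≡b with i ≟ j
... | yes _  = refl
... | no i≢j = cong (1 *_) (a≡b i≢j)

-- Single, double and triple sums over `Fin n`.

sum-0 : ∀ n → sum {n} (λ _ → 0) ≡ 0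
sum-0 = sum-replicate-zero

sum-1 : ∀ n → sum {n} (λ _ → 1) ≡ n
sum-1 zero    = refl
sum-1 (suc n) = cong suc (sum-1 n)

sum-δ : (i : Fin n) (f : Fin n → ℕ) → sum (λ j → δ i j * f j) ≡ f i
sum-δ {suc n} zero f = begin
  f zero + 0 + sum {n} (λ _ → 0)  ≡⟨ cong₂ _+_ (+-identityʳ _) (sum-0 n) ⟩
  f zero + 0                      ≡⟨ +-identityʳ _ ⟩
  f zero                          ∎
  where open ≡-Reasoning
sum-δ {suc n} (suc i) f = sum-δ i (f ∘ suc)

sum-δ̄ : (i : Fin n) (f : Fin n → ℕ) → f i + sum (λ j → δ̄ i j * f j) ≡ sum f
sum-δ̄ i f = begin
  f i + sum (λ j → δ̄ i j * f j)                       ≡⟨ cong (_+ sum (λ j → δ̄ i j * f j)) (sum-δ i f) ⟨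
  sum (λ j → δ i j * f j) + sum (λ j → δ̄ i j * f j)  ≡⟨ ∑-distrib-+ (λ j → δ i j * f j) _ ⟨
  sum (λ j → δ i j * f j + δ̄ i j * f j)              ≡⟨ sum-cong-≗ (λ j → *-distribʳ-+ (f j) (δ i j) _) ⟨
  sum (λ j → (δ i j + δ̄ i j) * f j)                  ≡⟨ sum-cong-≗ (λ j → trans (cong (_* f j) (δ+δ̄ i j)) (*-identityˡ _)) ⟩
  sum f                                               ∎
  where open ≡-Reasoning

sum² : (Fin n → Fin n → ℕ) → ℕ
sum² f = sum λ x → sum (f x)

sum³ : (Fin n → Fin n → Fin n → ℕ) → ℕ
sum³ f = sum λ x → sum² (f x)

sum²-cong : {f g : Fin n → Fin n → ℕ} → (∀ x y → f x y ≡ g x y) → sum² f ≡ sum² g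
sum²-cong f≗g = sum-cong-≗ λ x → sum-cong-≗ (f≗g x)

sum³-cong : {f g : Fin n → Fin n → Fin n → ℕ} → (∀ x y z → f x y z ≡ g x y z) → sum³ f ≡ sum³ g
sum³-cong f≗g = sum-cong-≗ λ x → sum²-cong (f≗g x)

sum²-+ : (f g : Fin n → Fin n → ℕ) → sum² (λ x y → f x y + g x y) ≡ sum² f + sum² g
sum²-+ f g = trans (sum-cong-≗ λ x → ∑-distrib-+ (f x) (g x)) (∑-distrib-+ (sum ∘ f) (sum ∘ g))

sum²-*ˡ : ∀ c (f : Fin n → Fin n → ℕ) → c * sum² f ≡ sum² (λ x y → c * f x y)
sum²-*ˡ c f = trans (*-distribˡ-sum c (sum ∘ f)) (sum-cong-≗ λ x → *-distribˡ-sum c (f x))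

sum³-*ˡ : ∀ c (f : Fin n → Fin n → Fin n → ℕ) → c * sum³ f ≡ sum³ (λ x y z → c * f x y z)
sum³-*ˡ c f = trans (*-distribˡ-sum c (sum² ∘ f)) (sum-cong-≗ λ x → sum²-*ˡ c (f x))

sum-sum²-comm : (f : Fin n → Fin n → Fin n → ℕ) →
                sum (λ u → sum² (f u)) ≡ sum² (λ x y → sum λ u → f u x y)
sum-sum²-comm f = trans (∑-comm (λ u x → sum (f u x))) (sum-cong-≗ λ x → ∑-comm (λ u → f u x))

sum-sum³-comm : (f : Fin n → Fin n → Fin n → Fin n → ℕ) →
                sum (λ u → sum³ (f u)) ≡ sum³ (λ x y z → sum λ u → f u x y z)
sum-sum³-comm f = trans (∑-comm (λ u x → sum² (f u x))) (sum-cong-≗ λ x → sum-sum²-comm (λ u → f u x))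

sum²-sum²-comm : (f : Fin n → Fin n → Fin n → Fin n → ℕ) →
                 sum² (λ u v → sum² (f u v)) ≡ sum² (λ x y → sum² (λ u v → f u v x y))
sum²-sum²-comm f = trans (sum-cong-≗ λ u → sum-sum²-comm (f u)) (sum-sum²-comm λ u x y → sum λ v → f u v x y)

sum²-sum³-comm : (f : Fin n → Fin n → Fin n → Fin n → Fin n → ℕ) →
                 sum² (λ u v → sum³ (f u v)) ≡ sum³ (λ x y z → sum² (λ u v → f u v x y z))
sum²-sum³-comm f = trans (sum-cong-≗ λ u → sum-sum³-comm (f u)) (sum-sum³-comm λ u x y z → sum λ v → f u v x y z)

sum²-δ : (p q : Fin n) (f : Fin n → Fin n → ℕ) → sum² (λ x y → δ p x * δ q y * f x y) ≡ f p q
sum²-δ p q f = begin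
  sum² (λ x y → δ p x * δ q y * f x y)          ≡⟨ sum²-cong (λ x y → *-assoc (δ p x) _ _) ⟩
  sum² (λ x y → δ p x * (δ q y * f x y))        ≡⟨ sum-cong-≗ (λ x → *-distribˡ-sum (δ p x) (λ y → δ q y * f x y)) ⟨
  sum (λ x → δ p x * sum (λ y → δ q y * f x y)) ≡⟨ sum-δ p _ ⟩
  sum (λ y → δ q y * f p y)                     ≡⟨ sum-δ q (f p) ⟩
  f p q                                         ∎
  where open ≡-Reasoning

module _ (τ τ⁻¹ : Fin n × Fin n → Fin n × Fin n)
         (invˡ : ∀ p → τ (τ⁻¹ p) ≡ p) (invʳ : ∀ p → τ⁻¹ (τ p) ≡ p) where

  private
    δ² : Fin n × Fin n → Fin n × Fin n → ℕ
    δ² (a , b) (c , d) = δ a c * δ b d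

    δ²-cong : ∀ p q r s → (p ≡ q → r ≡ s) → (r ≡ s → p ≡ q) → δ² p q ≡ δ² r s
    δ²-cong (a , b) (c , d) (a′ , b′) (c′ , d′) f g
      with a ≟ c | b ≟ d | a′ ≟ c′ | b′ ≟ d′
    ... | yes refl | yes refl | yes _ | yes _ = refl
    ... | yes refl | yes refl | no ≢  | _     = contradiction (cong proj₁ (f refl)) ≢
    ... | yes refl | yes refl | yes _ | no ≢  = contradiction (cong proj₂ (f refl)) ≢
    ... | no ≢     | _        | yes refl | yes refl = contradiction (cong proj₁ (g refl)) ≢
    ... | yes _    | no ≢     | yes refl | yes refl = contradiction (cong proj₂ (g refl)) ≢
    ... | no _     | _        | no _     | _     = refl
    ... | no _     | _        | yes _    | no _  = refl
    ... | yes _    | no _     | no _     | _     = refl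
    ... | yes _    | no _     | yes _    | no _  = refl

  -- `τ` permutes pairs and need not act coordinatewise. The value at `τ (u , v)` is spread out as a
  -- sum against `δ²`, the order of summation is exchanged, and reading `δ²` through `τ⁻¹` leaves a
  -- single nonzero inner term.
  sum²-reindex : (f : Fin n → Fin n → ℕ) →
                 sum² (λ u v → uncurry f (τ (u , v))) ≡ sum² f
  sum²-reindex f = begin
    sum² (λ u v → uncurry f (τ (u , v)))
      ≡⟨ (sum²-cong λ u v → sum²-δ (proj₁ (τ (u , v))) (proj₂ (τ (u , v))) f) ⟨
    sum² (λ u v → sum² λ x y → δ² (τ (u , v)) (x , y) * f x y)
      ≡⟨ sum²-sum²-comm (λ u v x y → δ² (τ (u , v)) (x , y) * f x y) ⟩
    sum² (λ x y → sum² λ u v → δ² (τ (u , v)) (x , y) * f x y)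
      ≡⟨ (sum²-cong λ x y → sum²-cong λ u v → cong (_* f x y) (flip u v x y)) ⟩
    sum² (λ x y → sum² λ u v → δ² (τ⁻¹ (x , y)) (u , v) * f x y)
      ≡⟨ (sum²-cong λ x y → sum²-δ (proj₁ (τ⁻¹ (x , y))) (proj₂ (τ⁻¹ (x , y))) λ _ _ → f x y) ⟩
    sum² f ∎
    where
    open ≡-Reasoning
    flip : ∀ u v x y → δ² (τ (u , v)) (x , y) ≡ δ² (τ⁻¹ (x , y)) (u , v)
    flip u v x y = δ²-cong (τ (u , v)) (x , y) (τ⁻¹ (x , y)) (u , v)
      (λ e → trans (cong τ⁻¹ (≡.sym e)) (invʳ _)) (λ e → trans (cong τ (≡.sym e)) (invˡ _))

-- Equality cases of inequalities between sums.

sum-mono-≤ : {f g : Fin n → ℕ} → (∀ i → f i ≤ g i) → sum f ≤ sum g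
sum-mono-≤ {zero}  f≤g = z≤n
sum-mono-≤ {suc n} f≤g = +-mono-≤ (f≤g zero) (sum-mono-≤ (f≤g ∘ suc))

sum-tight : {f g : Fin n → ℕ} → (∀ i → f i ≤ g i) → sum f ≡ sum g → ∀ i → f i ≡ g i
sum-tight {suc n} {f} {g} f≤g eq = tight
  where
  head≡ : f zero ≡ g zero
  -- The tails can only favour `g`, so equal totals force `g zero ≤ f zero`.
  head≡ = ≤-antisym (f≤g zero) (+-cancelʳ-≤ (sum (f ∘ suc)) _ _
    (≤-trans (+-monoʳ-≤ (g zero) (sum-mono-≤ (f≤g ∘ suc))) (≤-reflexive (≡.sym eq))))
  tight : ∀ i → f i ≡ g i
  tight zero    = head≡
  tight (suc i) = sum-tight (f≤g ∘ suc)
    (+-cancelˡ-≡ (g zero) _ _ (trans (cong (_+ sum (f ∘ suc)) (≡.sym head≡)) eq)) i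

-- The defect of `2mn ≤ m² + n²` is made explicit through the distance, so no truncated subtraction
-- occurs; the larger number is written as the smaller plus `k`.
m²+n²≡2mn+∣m-n∣² : ∀ m n → m * m + n * n ≡ 2 * (m * n) + ∣ m - n ∣ * ∣ m - n ∣
m²+n²≡2mn+∣m-n∣² m n with ≤-total m n
... | inj₁ m≤n with k , refl ← m≤n⇒∃[o]m+o≡n m≤n rewrite ∣m-m+n∣≡n m k = lemma m k
  where
  lemma : ∀ m k → m * m + (m + k) * (m + k) ≡ 2 * (m * (m + k)) + k * k
  lemma = solve-∀
... | inj₂ n≤m with k , refl ← m≤n⇒∃[o]m+o≡n n≤m rewrite ∣-∣-comm (n + k) n | ∣m-m+n∣≡n n k = lemma n k
  where
  lemma : ∀ n k → (n + k) * (n + k) + n * n ≡ 2 * ((n + k) * n) + k * k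
  lemma = solve-∀

-- Zero variance, in the form Σ 2cfᵢ = Σ (c² + fᵢ²), which needs no subtraction.
sum-moments⇒constant : (f : Fin n → ℕ) (c : ℕ) →
  sum f ≡ sum {n} (λ _ → c) → sum (λ i → f i * f i) ≡ sum {n} (λ _ → c * c) → ∀ i → f i ≡ c
sum-moments⇒constant {n} f c Σf Σf² i = ≡.sym (∣m-n∣≡0⇒m≡n d≡0)
  where
  Σ≡ : sum (λ j → 2 * (c * f j)) ≡ sum (λ j → c * c + f j * f j)
  Σ≡ = begin
    sum (λ j → 2 * (c * f j))                       ≡⟨ sum-cong-≗ (λ j → *-assoc 2 c (f j)) ⟨
    sum (λ j → 2 * c * f j)                         ≡⟨ *-distribˡ-sum (2 * c) f ⟨
    2 * c * sum f                                   ≡⟨ cong (2 * c *_) Σf ⟩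
    2 * c * sum {n} (λ _ → c)                       ≡⟨ *-distribˡ-sum {n} (2 * c) _ ⟩
    sum {n} (λ _ → 2 * c * c)                       ≡⟨ sum-cong-≗ {n} (λ _ → lemma c) ⟩
    sum {n} (λ _ → c * c + c * c)                   ≡⟨ ∑-distrib-+ {n} (λ _ → c * c) _ ⟩
    sum {n} (λ _ → c * c) + sum {n} (λ _ → c * c)   ≡⟨ cong (sum {n} (λ _ → c * c) +_) Σf² ⟨
    sum {n} (λ _ → c * c) + sum (λ j → f j * f j)   ≡⟨ ∑-distrib-+ (λ _ → c * c) (λ j → f j * f j) ⟨
    sum (λ j → c * c + f j * f j)                   ∎
    where
    open ≡-Reasoning
    lemma : ∀ c → 2 * c * c ≡ c * c + c * c
    lemma = solve-∀
  2cf≡ : 2 * (c * f i) ≡ c * c + f i * f i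
  2cf≡ = sum-tight
    (λ j → ≤-trans (m≤m+n _ _) (≤-reflexive (≡.sym (m²+n²≡2mn+∣m-n∣² c (f j))))) Σ≡ i
  d²≡0 : ∣ c - f i ∣ * ∣ c - f i ∣ ≡ 0
  d²≡0 = +-cancelˡ-≡ (2 * (c * f i)) _ _
    (trans (≡.sym (m²+n²≡2mn+∣m-n∣² c (f i))) (trans (≡.sym 2cf≡) (≡.sym (+-identityʳ _))))
  d≡0 : ∣ c - f i ∣ ≡ 0
  d≡0 with m*n≡0⇒m≡0∨n≡0 ∣ c - f i ∣ d²≡0
  ... | inj₁ e = e
  ... | inj₂ e = e

-- Triples of distinct vertices and the pairs whose deletion they survive.

distinct : Fin n → Fin n → Fin n → ℕ
distinct x y z = δ̄ x y * (δ̄ x z * δ̄ y z)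

distinct-guard : (x y z : Fin n) {a b : ℕ} →
  (x ≢ y → x ≢ z → y ≢ z → a ≡ b) → distinct x y z * a ≡ distinct x y z * b
distinct-guard x y z {a} {b} a≡b = begin
  distinct x y z * a                  ≡⟨ lemma (δ̄ x y) (δ̄ x z) (δ̄ y z) a ⟩
  δ̄ x y * (δ̄ x z * (δ̄ y z * a))     ≡⟨ (δ̄-guard x y λ x≢y → δ̄-guard x z λ x≢z → δ̄-guard y z (a≡b x≢y x≢z)) ⟩
  δ̄ x y * (δ̄ x z * (δ̄ y z * b))     ≡⟨ lemma (δ̄ x y) (δ̄ x z) (δ̄ y z) b ⟨
  distinct x y z * b                  ∎
  where
  open ≡-Reasoning
  lemma : ∀ p q r s → p * (q * r) * s ≡ p * (q * (r * s))
  lemma = solve-∀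

-- The excluded vertices are put back one at a time: a unit on the left is rewritten as the value of
-- the remaining indicator at the vertex put back.
sum-avoiding₂ : {x y : Fin n} → x ≢ y → 2 + sum (λ w → δ̄ x w * δ̄ y w) ≡ n
sum-avoiding₂ {n} {x} {y} x≢y = begin
  2 + sum (λ w → δ̄ x w * δ̄ y w)            ≡⟨ cong (λ e → suc (e + sum (λ w → δ̄ x w * δ̄ y w))) (δ̄-≢ (x≢y ∘ ≡.sym)) ⟨
  suc (δ̄ y x + sum (λ w → δ̄ x w * δ̄ y w))  ≡⟨ cong suc (sum-δ̄ x (δ̄ y)) ⟩
  suc (sum (δ̄ y))                            ≡⟨ cong suc (sum-cong-≗ (λ w → *-identityʳ (δ̄ y w))) ⟨
  1 + sum (λ w → δ̄ y w * 1)                  ≡⟨ sum-δ̄ y (λ _ → 1) ⟩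
  sum {n} (λ _ → 1)                           ≡⟨ sum-1 n ⟩
  n                                           ∎
  where open ≡-Reasoning

sum-avoiding₃ : {x y z : Fin n} → x ≢ y → x ≢ z → y ≢ z →
                3 + sum (λ w → δ̄ x w * (δ̄ y w * δ̄ z w)) ≡ n
sum-avoiding₃ {n} {x} {y} {z} x≢y x≢z y≢z = begin
  3 + sum (λ w → δ̄ x w * (δ̄ y w * δ̄ z w))                    ≡⟨ cong (λ e → 2 + (e + sum (λ w → δ̄ x w * (δ̄ y w * δ̄ z w)))) 1≡ ⟩
  2 + (δ̄ y x * δ̄ z x + sum (λ w → δ̄ x w * (δ̄ y w * δ̄ z w)))  ≡⟨ cong (2 +_) (sum-δ̄ x (λ w → δ̄ y w * δ̄ z w)) ⟩
  2 + sum (λ w → δ̄ y w * δ̄ z w)                                ≡⟨ sum-avoiding₂ y≢z ⟩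
  n                                                             ∎
  where
  open ≡-Reasoning
  1≡ : 1 ≡ δ̄ y x * δ̄ z x
  1≡ = ≡.sym (cong₂ _*_ (δ̄-≢ (x≢y ∘ ≡.sym)) (δ̄-≢ (x≢z ∘ ≡.sym)))

-- The square of the sum splits into its diagonal and off-diagonal terms, and for a 0/1-valued `g`
-- the diagonal is `sum g` itself.
sum²-off-diagonal : (g : Fin n → ℕ) → (∀ u → g u * g u ≡ g u) →
                    sum g + sum² (λ u v → δ̄ u v * (g u * g v)) ≡ sum g * sum g
sum²-off-diagonal g idem = begin
  sum g + sum² (λ u v → δ̄ u v * (g u * g v))               ≡⟨ ∑-distrib-+ g _ ⟨
  sum (λ u → g u + sum (λ v → δ̄ u v * (g u * g v)))        ≡⟨ sum-cong-≗ (λ u → cong₂ _+_ (≡.sym (idem u)) (sum-cong-≗ (λ v → lemma (δ̄ u v) (g u) (g v)))) ⟩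
  sum (λ u → g u * g u + sum (λ v → g u * (δ̄ u v * g v)))  ≡⟨ sum-cong-≗ (λ u → cong (g u * g u +_) (*-distribˡ-sum (g u) (λ v → δ̄ u v * g v))) ⟨
  sum (λ u → g u * g u + g u * sum (λ v → δ̄ u v * g v))    ≡⟨ sum-cong-≗ (λ u → *-distribˡ-+ (g u) _ _) ⟨
  sum (λ u → g u * (g u + sum (λ v → δ̄ u v * g v)))        ≡⟨ sum-cong-≗ (λ u → cong (g u *_) (sum-δ̄ u g)) ⟩
  sum (λ u → g u * sum g)                                   ≡⟨ *-distribʳ-sum (sum g) g ⟨
  sum g * sum g                                             ∎
  where
  open ≡-Reasoning
  lemma : ∀ d p q → d * (p * q) ≡ p * (d * q)
  lemma = solve-∀

off : Fin n → Fin n → Fin n → ℕ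
off u v x = δ̄ x u * δ̄ x v

off-guard : (u v x : Fin n) {a b : ℕ} → (x ≢ u → x ≢ v → a ≡ b) → off u v x * a ≡ off u v x * b
off-guard u v x {a} {b} a≡b = begin
  off u v x * a        ≡⟨ *-assoc (δ̄ x u) _ _ ⟩
  δ̄ x u * (δ̄ x v * a)    ≡⟨ (δ̄-guard x u λ x≢u → δ̄-guard x v (a≡b x≢u)) ⟩
  δ̄ x u * (δ̄ x v * b)    ≡⟨ *-assoc (δ̄ x u) _ _ ⟨
  off u v x * b        ∎
  where open ≡-Reasoning

off-swap : (u v x : Fin n) → off u v x ≡ off v u x
off-swap u v x = *-comm (δ̄ x u) (δ̄ x v)

-- Summation over the triples of the card missing `u` and `v`, weighted over all of `Fin n` so that
-- different cards share one index set.
sumOff : Fin n → Fin n → (Fin n → Fin n → Fin n → ℕ) → ℕ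
sumOff u v F = sum³ λ x y z → off u v x * (off u v y * (off u v z * F x y z))

sumOff-swap : ∀ u v (F : Fin n → Fin n → Fin n → ℕ) → sumOff u v F ≡ sumOff v u F
sumOff-swap u v F = sum³-cong λ x y z →
  cong₂ _*_ (off-swap u v x) (cong₂ _*_ (off-swap u v y) (cong (_* F x y z) (off-swap u v z)))

-- Kelly's lemma, with n = 5 + b: three distinct vertices all survive in (n-3)(n-4) of the deletions of an ordered pair.
sum²-sumOff : ∀ {n} (b : ℕ) → n ≡ 5 + b → (f : Fin n → Fin n → Fin n → ℕ) →
  sum² (λ u v → δ̄ u v * sumOff u v (λ x y z → distinct x y z * f x y z))
  ≡ suc b * suc (suc b) * sum³ (λ x y z → distinct x y z * f x y z)
sum²-sumOff {n} b n≡ f = begin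
  sum² (λ u v → δ̄ u v * sumOff u v F)
    ≡⟨ (sum²-cong λ u v → sum³-*ˡ (δ̄ u v) λ x y z → off u v x * (off u v y * (off u v z * F x y z))) ⟩
  sum² (λ u v → sum³ λ x y z → δ̄ u v * (off u v x * (off u v y * (off u v z * F x y z))))
    ≡⟨ sum²-sum³-comm (λ u v x y z → δ̄ u v * (off u v x * (off u v y * (off u v z * F x y z)))) ⟩
  sum³ (λ x y z → sum² λ u v → δ̄ u v * (off u v x * (off u v y * (off u v z * F x y z))))
    ≡⟨ (sum³-cong λ x y z → sum²-cong λ u v →
          lemma (δ̄ u v) (δ̄ x u) (δ̄ x v) (δ̄ y u) (δ̄ y v) (δ̄ z u) (δ̄ z v) (F x y z)) ⟩
  sum³ (λ x y z → sum² λ u v → F x y z * (δ̄ u v * (avoid x y z u * avoid x y z v)))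
    ≡⟨ (sum³-cong λ x y z → sum²-*ˡ (F x y z) (λ u v → δ̄ u v * (avoid x y z u * avoid x y z v))) ⟨
  sum³ (λ x y z → F x y z * pairs x y z)
    ≡⟨ sum³-cong (λ x y z → weight x y z) ⟩
  sum³ (λ x y z → suc b * suc (suc b) * F x y z)
    ≡⟨ sum³-*ˡ (suc b * suc (suc b)) F ⟨
  suc b * suc (suc b) * sum³ F ∎
  where
  open ≡-Reasoning
  F : Fin n → Fin n → Fin n → ℕ
  F x y z = distinct x y z * f x y z
  avoid : Fin n → Fin n → Fin n → Fin n → ℕ
  avoid x y z w = δ̄ x w * (δ̄ y w * δ̄ z w)
  pairs : Fin n → Fin n → Fin n → ℕ
  pairs x y z = sum² λ u v → δ̄ u v * (avoid x y z u * avoid x y z v)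
  lemma : ∀ d xu xv yu yv zu zv e → d * ((xu * xv) * ((yu * yv) * ((zu * zv) * e))) ≡
                                    e * (d * ((xu * (yu * zu)) * (xv * (yv * zv))))
  lemma = solve-∀
  δ̄-idem : (i j : Fin n) → δ̄ i j * δ̄ i j ≡ δ̄ i j
  δ̄-idem i j with does (i ≟ j)
  ... | true  = refl
  ... | false = refl
  avoid-idem : ∀ x y z w → avoid x y z w * avoid x y z w ≡ avoid x y z w
  avoid-idem x y z w = trans (square (δ̄ x w) (δ̄ y w) (δ̄ z w))
    (cong₂ _*_ (δ̄-idem x w) (cong₂ _*_ (δ̄-idem y w) (δ̄-idem z w)))
    where
    square : ∀ p q r → (p * (q * r)) * (p * (q * r)) ≡ (p * p) * ((q * q) * (r * r))
    square = solve-∀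
  -- `avoid x y z` has sum `2 + b`. The square of this unfolds definitionally to
  -- `(2 + b) + (1 + b) * (2 + b)`, so cancelling `2 + b` leaves the number of ordered pairs.
  pairs≡ : ∀ x y z → x ≢ y → x ≢ z → y ≢ z → pairs x y z ≡ suc b * suc (suc b)
  pairs≡ x y z x≢y x≢z y≢z = +-cancelˡ-≡ (suc (suc b)) _ _
    (trans (cong (_+ pairs x y z) (≡.sym Σ≡)) (trans (sum²-off-diagonal (avoid x y z) (avoid-idem x y z)) (cong₂ _*_ Σ≡ Σ≡)))
    where
    Σ≡ : sum (avoid x y z) ≡ suc (suc b)
    Σ≡ = +-cancelˡ-≡ 3 _ _ (trans (sum-avoiding₃ x≢y x≢z y≢z) n≡)
  weight : ∀ x y z → F x y z * pairs x y z ≡ suc b * suc (suc b) * F x y z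
  weight x y z = begin
    distinct x y z * f x y z * pairs x y z                     ≡⟨ *-assoc (distinct x y z) _ _ ⟩
    distinct x y z * (f x y z * pairs x y z)                   ≡⟨ (distinct-guard x y z λ p q r → cong (f x y z *_) (pairs≡ x y z p q r)) ⟩
    distinct x y z * (f x y z * (suc b * suc (suc b)))         ≡⟨ *-assoc (distinct x y z) _ _ ⟨
    distinct x y z * f x y z * (suc b * suc (suc b))           ≡⟨ *-comm (F x y z) _ ⟩
    suc b * suc (suc b) * F x y z                              ∎

-- Degrees and the counts of edges and two-edge paths.

bit : Bool → ℕ
bit b = if b then 1 else 0

a : Graph n → Fin n → Fin n → ℕ
a G x y = bit (adj G x y)

deg : Graph n → Fin n → ℕ
deg G x = sum (a G x)

a-irref : (G : Graph n) (x : Fin n) → a G x x ≡ 0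
a-irref G x rewrite irref G x = refl

a-sym : (G : Graph n) (x y : Fin n) → a G x y ≡ a G y x
a-sym G x y rewrite sym G x y = refl

a-idem : (G : Graph n) (x y : Fin n) → a G x y * a G x y ≡ a G x y
a-idem G x y with adj G x y
... | true  = refl
... | false = refl

δ̄-a : (G : Graph n) (x y : Fin n) → δ̄ x y * a G x y ≡ a G x y
δ̄-a G x y with x ≟ y
... | yes refl = ≡.sym (a-irref G x)
... | no _     = *-identityˡ _

-- `edge` ignores its third vertex: both counts thereby become sums over triples, and one counting
-- lemma serves for both.
edge cherry : Graph n → Fin n → Fin n → Fin n → ℕ
edge   G x y z = a G x y
cherry G x y z = a G x y * a G x z

module _ {n : ℕ} (G : Graph n) where

  -- The third vertex is free, which gives `c` choices for every ordered adjacent pair.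
  sum³-edge : ∀ {c} → n ≡ 2 + c → sum³ (λ x y z → distinct x y z * edge G x y z) ≡ c * sum (deg G)
  sum³-edge {c} n≡ = begin
    sum³ (λ x y z → distinct x y z * a G x y)
      ≡⟨ sum³-cong (λ x y z → lemma (δ̄ x y) (δ̄ x z) (δ̄ y z) (a G x y)) ⟩
    sum³ (λ x y z → δ̄ x y * a G x y * (δ̄ x z * δ̄ y z))
      ≡⟨ sum²-cong (λ x y → *-distribˡ-sum (δ̄ x y * a G x y) (λ z → δ̄ x z * δ̄ y z)) ⟨
    sum² (λ x y → δ̄ x y * a G x y * sum (λ z → δ̄ x z * δ̄ y z))
      ≡⟨ sum²-cong inner ⟩
    sum² (λ x y → c * a G x y)
      ≡⟨ sum²-*ˡ c (a G) ⟨
    c * sum (deg G) ∎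
    where
    open ≡-Reasoning
    lemma : ∀ p q r s → p * (q * r) * s ≡ p * s * (q * r)
    lemma = solve-∀
    inner : ∀ x y → δ̄ x y * a G x y * sum (λ z → δ̄ x z * δ̄ y z) ≡ c * a G x y
    inner x y = begin
      δ̄ x y * a G x y * sum (λ z → δ̄ x z * δ̄ y z)    ≡⟨ *-assoc (δ̄ x y) _ _ ⟩
      δ̄ x y * (a G x y * sum (λ z → δ̄ x z * δ̄ y z))  ≡⟨ δ̄-guard x y (λ x≢y → cong (a G x y *_) (+-cancelˡ-≡ 2 _ _ (trans (sum-avoiding₂ x≢y) n≡))) ⟩
      δ̄ x y * (a G x y * c)                             ≡⟨ *-assoc (δ̄ x y) _ _ ⟨
      δ̄ x y * a G x y * c                               ≡⟨ cong (_* c) (δ̄-a G x y) ⟩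
      a G x y * c                                        ≡⟨ *-comm (a G x y) c ⟩
      c * a G x y                                        ∎

  -- In the square of `deg G x` the terms with equal neighbours add up to `deg G x`, and the others
  -- are the two-edge paths centred at `x`. The guards between `x` and its neighbours drop out
  -- because adjacency is loopless.
  sum³-cherry : sum (deg G) + sum³ (λ x y z → distinct x y z * cherry G x y z) ≡ sum (λ x → deg G x * deg G x)
  sum³-cherry = begin
    sum (deg G) + sum³ (λ x y z → distinct x y z * cherry G x y z)
      ≡⟨ cong (sum (deg G) +_) (sum³-cong drop-δ̄) ⟩
    sum (deg G) + sum³ (λ x y z → δ̄ y z * (a G x y * a G x z))
      ≡⟨ ∑-distrib-+ (deg G) _ ⟨
    sum (λ x → deg G x + sum² (λ y z → δ̄ y z * (a G x y * a G x z)))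
      ≡⟨ sum-cong-≗ (λ x → sum²-off-diagonal (a G x) (a-idem G x)) ⟩
    sum (λ x → deg G x * deg G x) ∎
    where
    open ≡-Reasoning
    lemma : ∀ p q r s t → p * (q * r) * (s * t) ≡ r * ((p * s) * (q * t))
    lemma = solve-∀
    drop-δ̄ : ∀ x y z → distinct x y z * cherry G x y z ≡ δ̄ y z * (a G x y * a G x z)
    drop-δ̄ x y z = trans (lemma (δ̄ x y) (δ̄ x z) (δ̄ y z) (a G x y) (a G x z))
      (cong (δ̄ y z *_) (cong₂ _*_ (δ̄-a G x y) (δ̄-a G x z)))

-- Neighbourhood sizes as sums of adjacency bits.

∣tabulate∣ : (f : Fin n → Bool) → ∣ tabulate f ∣ ≡ sum (λ i → bit (f i))
∣tabulate∣ {zero}  f = refl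
∣tabulate∣ {suc n} f with f zero
... | true  = cong suc (∣tabulate∣ (f ∘ suc))
... | false = ∣tabulate∣ (f ∘ suc)

∣tabulate∩tabulate∣ : (f g : Fin n → Bool) →
  ∣ tabulate f ∩ tabulate g ∣ ≡ sum (λ i → bit (f i) * bit (g i))
∣tabulate∩tabulate∣ {zero}  f g = refl
∣tabulate∩tabulate∣ {suc n} f g with f zero | g zero
... | true  | true  = cong suc (∣tabulate∩tabulate∣ (f ∘ suc) (g ∘ suc))
... | true  | false = ∣tabulate∩tabulate∣ (f ∘ suc) (g ∘ suc)
... | false | true  = ∣tabulate∩tabulate∣ (f ∘ suc) (g ∘ suc)
... | false | false = ∣tabulate∩tabulate∣ (f ∘ suc) (g ∘ suc)

codeg : Graph n → Fin n → Fin n → ℕ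
codeg G u v = sum λ x → a G u x * a G v x

∣N∣ : (G : Graph n) (v : Fin n) → ∣ N G v ∣ ≡ deg G v
∣N∣ G v = ∣tabulate∣ (adj G v)

∣N∩N∣ : (G : Graph n) (u v : Fin n) → ∣ N G u ∩ N G v ∣ ≡ codeg G u v
∣N∩N∣ G u v = ∣tabulate∩tabulate∣ (adj G u) (adj G v)

-- Cards as complements of pairs of vertices.

infix 8 ∁⁅_,_⁆
∁⁅_,_⁆ : Fin n → Fin n → Subset n
∁⁅ u , v ⁆ = ∁ (⁅ u ⁆ ∪ ⁅ v ⁆)

∈∁⁅⁆⁺ : {x u v : Fin n} → x ≢ u → x ≢ v → x ∈ ∁⁅ u , v ⁆
∈∁⁅⁆⁺ x≢u x≢v = x∉p⇒x∈∁p λ x∈ → case (x∈p∪q⁻ _ _ x∈)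
  where
  case : _ ⊎ _ → _
  case (inj₁ x∈⁅u⁆) = x≢u (x∈⁅y⁆⇒x≡y _ x∈⁅u⁆)
  case (inj₂ x∈⁅v⁆) = x≢v (x∈⁅y⁆⇒x≡y _ x∈⁅v⁆)

∈∁⁅⁆⁻ : {x u v : Fin n} → x ∈ ∁⁅ u , v ⁆ → x ≢ u × x ≢ v
∈∁⁅⁆⁻ x∈ = (λ { refl → x∈∁p⇒x∉p x∈ (x∈p∪q⁺ (inj₁ (x∈⁅x⁆ _))) })
         , (λ { refl → x∈∁p⇒x∉p x∈ (x∈p∪q⁺ (inj₂ (x∈⁅x⁆ _))) })

∣⁅u⁆∪⁅v⁆∣≡2 : {u v : Fin n} → u ≢ v → ∣ ⁅ u ⁆ ∪ ⁅ v ⁆ ∣ ≡ 2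
∣⁅u⁆∪⁅v⁆∣≡2 {u = zero}  {zero}  u≢v = contradiction refl u≢v
∣⁅u⁆∪⁅v⁆∣≡2 {u = zero}  {suc v} u≢v = cong suc (trans (cong ∣_∣ (∪-identityˡ ⁅ v ⁆)) (∣⁅x⁆∣≡1 v))
∣⁅u⁆∪⁅v⁆∣≡2 {u = suc u} {zero}  u≢v = cong suc (trans (cong ∣_∣ (∪-identityʳ ⁅ u ⁆)) (∣⁅x⁆∣≡1 u))
∣⁅u⁆∪⁅v⁆∣≡2 {u = suc u} {suc v} u≢v = ∣⁅u⁆∪⁅v⁆∣≡2 (u≢v ∘ cong suc)

∣∁⁅⁆∣ : {u v : Fin n} → u ≢ v → ∣ ∁⁅ u , v ⁆ ∣ ≡ n ∸ 2
∣∁⁅⁆∣ {n} {u} {v} u≢v = trans (∣∁p∣≡n∸∣p∣ (⁅ u ⁆ ∪ ⁅ v ⁆)) (cong (n ∸_) (∣⁅u⁆∪⁅v⁆∣≡2 u≢v))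

∣p∣≡0⇒p≡⊥ : (p : Subset n) → ∣ p ∣ ≡ 0 → p ≡ ⊥
∣p∣≡0⇒p≡⊥ []            _ = refl
∣p∣≡0⇒p≡⊥ (outside ∷ p) e = cong (outside ∷_) (∣p∣≡0⇒p≡⊥ p e)

∣p∣≡1⇒p≡⁅u⁆ : (p : Subset n) → ∣ p ∣ ≡ 1 → ∃ λ u → p ≡ ⁅ u ⁆
∣p∣≡1⇒p≡⁅u⁆ (inside  ∷ p) e = zero , cong (inside ∷_) (∣p∣≡0⇒p≡⊥ p (suc-injective e))
∣p∣≡1⇒p≡⁅u⁆ (outside ∷ p) e with u , refl ← ∣p∣≡1⇒p≡⁅u⁆ p e = suc u , refl

-- Listing a pair in increasing order gives each two-element set exactly one name, which makes the
-- passage to cards a bijection.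
OrdPair : ℕ → Set
OrdPair n = Σ (Fin n × Fin n) λ (u , v) → u Fin.< v

ordPair-≡ : {p q : OrdPair n} → proj₁ p ≡ proj₁ q → p ≡ q
ordPair-≡ {p = p , u<v} {.p , u<v′} refl = cong (p ,_) (Finₚ.<-irrelevant u<v u<v′)

∣p∣≡2⇒p≡⁅u⁆∪⁅v⁆ : (p : Subset n) → ∣ p ∣ ≡ 2 →
  Σ (OrdPair n) λ ((u , v) , _) → p ≡ ⁅ u ⁆ ∪ ⁅ v ⁆
∣p∣≡2⇒p≡⁅u⁆∪⁅v⁆ (inside  ∷ p) e with v , refl ← ∣p∣≡1⇒p≡⁅u⁆ p (suc-injective e) =
  ((zero , suc v) , s≤s z≤n) , cong (inside ∷_) (≡.sym (∪-identityˡ ⁅ v ⁆))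
∣p∣≡2⇒p≡⁅u⁆∪⁅v⁆ (outside ∷ p) e with ((u , v) , u<v) , refl ← ∣p∣≡2⇒p≡⁅u⁆∪⁅v⁆ p e =
  ((suc u , suc v) , s≤s u<v) , refl

∁-involutive : (p : Subset n) → ∁ (∁ p) ≡ p
∁-involutive []      = refl
∁-involutive (b ∷ p) = cong₂ _∷_ (not-involutive b) (∁-involutive p)

∁⁅⁆-injective : (p q : OrdPair n) →
  let (u , v) , _ = p; (u′ , v′) , _ = q in ∁⁅ u , v ⁆ ≡ ∁⁅ u′ , v′ ⁆ → p ≡ q
∁⁅⁆-injective ((u , v) , u<v) ((u′ , v′) , u′<v′) eq with member u (inj₁ refl) | member v (inj₂ refl)
  where
  member : ∀ x → x ≡ u ⊎ x ≡ v → x ≡ u′ ⊎ x ≡ v′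
  member x x∈ with x ≟ u′ | x ≟ v′
  ... | yes e | _     = inj₁ e
  ... | no _  | yes e = inj₂ e
  -- A vertex outside the second pair would lie in the second card, hence in the first, from which
  -- it was deleted.
  ... | no x≢u′ | no x≢v′ with ∈∁⁅⁆⁻ (subst (x ∈_) (≡.sym eq) (∈∁⁅⁆⁺ x≢u′ x≢v′)) | x∈
  ...   | x≢u , _ | inj₁ e = contradiction e x≢u
  ...   | _ , x≢v | inj₂ e = contradiction e x≢v
... | inj₁ refl | inj₂ refl = ordPair-≡ refl
... | inj₁ refl | inj₁ refl = contradiction u<v (Finₚ.<-irrefl refl)
... | inj₂ refl | inj₂ refl = contradiction u<v (Finₚ.<-irrefl refl)
-- If the pairs matched crosswise, their two orderings would contradict each other.
... | inj₂ refl | inj₁ refl = contradiction u<v (Finₚ.<-asym u′<v′)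

kSubset-≡ : ∀ {k} {S T : KSubset n k} → proj₁ S ≡ proj₁ T → S ≡ T
kSubset-≡ {S = S , e} {.S , e′} refl = cong (S ,_) (≡-irrelevant e e′)

deletePair : {u v : Fin n} → u ≢ v → KSubset n (n ∸ 2)
deletePair {u = u} {v} u≢v = ∁⁅ u , v ⁆ , ∣∁⁅⁆∣ u≢v

-- The complement of a card has `n ∸ (n ∸ 2)` elements, which is 2 because `2 ≤ n`; hence it is a
-- pair.
deletedPair : 2 ≤ n → (S : KSubset n (n ∸ 2)) →
              Σ (OrdPair n) λ ((u , v) , _) → proj₁ S ≡ ∁⁅ u , v ⁆
deletedPair {n} 2≤n (S , ∣S∣) with p , ∁S≡ ← ∣p∣≡2⇒p≡⁅u⁆∪⁅v⁆ (∁ S)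
                                     (trans (∣∁p∣≡n∸∣p∣ S) (trans (cong (n ∸_) ∣S∣) (m∸[m∸n]≡n 2≤n)))
  = p , trans (≡.sym (∁-involutive S)) (cong ∁ ∁S≡)

ordPair↔kSubset : 2 ≤ n → OrdPair n ↔ KSubset n (n ∸ 2)
ordPair↔kSubset {n} 2≤n = mk↔ₛ′
  (λ (_ , u<v) → deletePair (Finₚ.<⇒≢ u<v))
  (λ S → proj₁ (deletedPair 2≤n S))
  (λ S → kSubset-≡ (≡.sym (proj₂ (deletedPair 2≤n S))))
  (λ (p , u<v) → ≡.sym (∁⁅⁆-injective _ _ (proj₂ (deletedPair 2≤n (deletePair (Finₚ.<⇒≢ u<v))))))

-- Isomorphisms of cards as permutations of all vertices.

-- The permutation acts on the whole vertex set and takes deleted pair to deleted pair, so full sums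
-- can be reindexed along it. Nothing is demanded of adjacencies at `u` or `v`.
record CardIso (G H : Graph n) (u v u′ v′ : Fin n) : Set where
  field
    π        : Fin n ↔ Fin n
    π-u      : Inverse.to π u ≡ u′
    π-v      : Inverse.to π v ≡ v′
    adj-off  : ∀ {x y} → x ≢ u → x ≢ v → y ≢ u → y ≢ v →
               adj H (Inverse.to π x) (Inverse.to π y) ≡ adj G x y

  to : Fin n → Fin n
  to = Inverse.to π

  to-injective : ∀ {x y} → to x ≡ to y → x ≡ y
  to-injective {x} {y} e = trans (≡.sym (Inverse.strictlyInverseʳ π x))
    (trans (cong (Inverse.from π) e) (Inverse.strictlyInverseʳ π y))

  a-off : ∀ {x y} → x ≢ u → x ≢ v → y ≢ u → y ≢ v → a G x y ≡ a H (to x) (to y)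
  a-off x≢u x≢v y≢u y≢v = cong bit (≡.sym (adj-off x≢u x≢v y≢u y≢v))

  δ̄-to : ∀ x y → δ̄ x y ≡ δ̄ (to x) (to y)
  δ̄-to x y = δ̄-cong (cong to) to-injective

  off-to : ∀ x → off u v x ≡ off u′ v′ (to x)
  off-to x = cong₂ _*_ (trans (δ̄-to x u) (cong (δ̄ (to x)) π-u)) (trans (δ̄-to x v) (cong (δ̄ (to x)) π-v))

patch : (u v p q : Fin n) (f : Fin n → Fin n) → Fin n → Fin n
patch u v p q f x = if does (x ≟ u) then p else if does (x ≟ v) then q else f x

module _ {u v p q : Fin n} {f : Fin n → Fin n} where

  patch-fst : patch u v p q f u ≡ p
  patch-fst rewrite dec-true (u ≟ u) refl = refl

  patch-snd : u ≢ v → patch u v p q f v ≡ q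
  patch-snd u≢v rewrite dec-false (v ≟ u) (u≢v ∘ ≡.sym) | dec-true (v ≟ v) refl = refl

  patch-off : ∀ {x} → x ≢ u → x ≢ v → patch u v p q f x ≡ f x
  patch-off {x} x≢u x≢v rewrite dec-false (x ≟ u) x≢u | dec-false (x ≟ v) x≢v = refl

-- `f` is overwritten only on the deleted pair. Injectivity survives because `f` maps the card into
-- the other card, away from `u′` and `v′`; the inverse takes its preimages from `surj`.
cardIso : {G H : Graph n} {u v u′ v′ : Fin n} → u ≢ v → u′ ≢ v′ →
          InducedIso G ∁⁅ u , v ⁆ H ∁⁅ u′ , v′ ⁆ → CardIso G H u v u′ v′
cardIso {n} {G} {H} {u} {v} {u′} {v′} u≢v u′≢v′ (f , into , inj , surj , iso) = record
  { π       = mk↔ₛ′ to from to-from from-to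
  ; π-u     = to-u
  ; π-v     = to-v
  ; adj-off = λ x≢u x≢v y≢u y≢v → trans (cong₂ (adj H) (to-off x≢u x≢v) (to-off y≢u y≢v))
                (iso _ _ (∈∁⁅⁆⁺ x≢u x≢v) (∈∁⁅⁆⁺ y≢u y≢v))
  }
  where
  to from : Fin n → Fin n
  to = patch u v u′ v′ f
  to-u : to u ≡ u′
  to-u = patch-fst {u = u} {v} {u′} {v′} {f}
  to-v : to v ≡ v′
  to-v = patch-snd {u = u} {v} {u′} {v′} {f} u≢v
  to-off : ∀ {x} → x ≢ u → x ≢ v → to x ≡ f x
  to-off = patch-off {u = u} {v} {u′} {v′} {f}
  from y with y ≟ u′ | y ≟ v′
  ... | yes _   | _       = u
  ... | no _    | yes _   = v
  ... | no y≢u′ | no y≢v′ = proj₁ (surj y (∈∁⁅⁆⁺ y≢u′ y≢v′))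
  to-from : ∀ y → to (from y) ≡ y
  to-from y with y ≟ u′ | y ≟ v′
  ... | yes refl | _        = to-u
  ... | no _     | yes refl = to-v
  ... | no y≢u′  | no y≢v′ with x , x∈ , refl ← surj y (∈∁⁅⁆⁺ y≢u′ y≢v′) =
    to-off (proj₁ (∈∁⁅⁆⁻ x∈)) (proj₂ (∈∁⁅⁆⁻ x∈))
  to-injective : ∀ x y → to x ≡ to y → x ≡ y
  to-injective x y eq with x ≟ u | x ≟ v | y ≟ u | y ≟ v
  ... | yes refl | _        | yes refl | _        = refl
  ... | no _     | yes refl | no _     | yes refl = refl
  ... | yes refl | _        | no _     | yes refl = contradiction eq u′≢v′
  ... | no _     | yes refl | yes refl | _        = contradiction (≡.sym eq) u′≢v′
  ... | yes refl | _        | no y≢u   | no y≢v   = contradiction (≡.sym eq) (proj₁ (∈∁⁅⁆⁻ (into y (∈∁⁅⁆⁺ y≢u y≢v))))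
  ... | no _     | yes refl | no y≢u   | no y≢v   = contradiction (≡.sym eq) (proj₂ (∈∁⁅⁆⁻ (into y (∈∁⁅⁆⁺ y≢u y≢v))))
  ... | no x≢u   | no x≢v   | yes refl | _        = contradiction eq (proj₁ (∈∁⁅⁆⁻ (into x (∈∁⁅⁆⁺ x≢u x≢v))))
  ... | no x≢u   | no x≢v   | no _     | yes refl = contradiction eq (proj₂ (∈∁⁅⁆⁻ (into x (∈∁⁅⁆⁺ x≢u x≢v))))
  ... | no x≢u   | no x≢v   | no y≢u   | no y≢v   = inj x y (∈∁⁅⁆⁺ x≢u x≢v) (∈∁⁅⁆⁺ y≢u y≢v) eq
  from-to : ∀ x → from (to x) ≡ x
  -- A right inverse of an injective map is also a left inverse.
  from-to x = to-injective _ _ (to-from (to x))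

-- The `off` weights kill every triple that meets the deleted pair, so agreement on survivors is
-- enough. The weights are carried along by `π`, and each of the three variables is then reindexed
-- by it.
sumOff-cong : {G H : Graph n} {u v u′ v′ : Fin n} (c : CardIso G H u v u′ v′) → let open CardIso c in
  {F E : Fin n → Fin n → Fin n → ℕ} →
  (∀ {x y z} → x ≢ u → x ≢ v → y ≢ u → y ≢ v → z ≢ u → z ≢ v →
     F x y z ≡ E (to x) (to y) (to z)) →
  sumOff u v F ≡ sumOff u′ v′ E
sumOff-cong {n} {u = u} {v} {u′} {v′} c {F} {E} F≡E = begin
  sumOff u v F
    ≡⟨ (sum³-cong λ x y z → off-guard u v x λ p q → off-guard u v y λ r s → off-guard u v z λ t w → F≡E p q r s t w) ⟩
  sum³ (λ x y z → off u v x * (off u v y * (off u v z * E (to x) (to y) (to z))))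
    ≡⟨ (sum³-cong λ x y z → cong₂ _*_ (off-to x) (cong₂ _*_ (off-to y) (cong (_* E (to x) (to y) (to z)) (off-to z)))) ⟩
  sum³ (λ x y z → K (to x) (to y) (to z))
    ≡⟨ (sum²-cong λ x y → sum-permute (K (to x) (to y)) π) ⟨
  sum² (λ x y → sum (K (to x) (to y)))
    ≡⟨ (sum-cong-≗ λ x → sum-permute (λ y → sum (K (to x) y)) π) ⟨
  sum (λ x → sum² (K (to x)))
    ≡⟨ sum-permute (λ x → sum² (K x)) π ⟨
  sumOff u′ v′ E ∎
  where
  open ≡-Reasoning
  open CardIso c
  K : Fin n → Fin n → Fin n → ℕ
  K x y z = off u′ v′ x * (off u′ v′ y * (off u′ v′ z * E x y z))

-- Passing between ordered pairs and increasing pairs.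

lt : Fin n → Fin n → ℕ
lt u v = if does (u Fin.<? v) then 1 else 0

lt-< : {u v : Fin n} → u Fin.< v → lt u v ≡ 1
lt-< {u = u} {v} u<v rewrite dec-true (u Fin.<? v) u<v = refl

lt-≮ : {u v : Fin n} → ¬ u Fin.< v → lt u v ≡ 0
lt-≮ {u = u} {v} u≮v rewrite dec-false (u Fin.<? v) u≮v = refl

lt+lt : (u v : Fin n) → lt u v + lt v u ≡ δ̄ u v
lt+lt u v with Finₚ.<-cmp u v
... | tri< u<v u≢v v≮u = trans (cong₂ _+_ (lt-< u<v) (lt-≮ v≮u)) (≡.sym (δ̄-≢ u≢v))
... | tri≈ u≮v refl _  = trans (cong₂ _+_ (lt-≮ u≮v) (lt-≮ u≮v)) (≡.sym (δ̄-refl u))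
... | tri> u≮v u≢v v<u = trans (cong₂ _+_ (lt-≮ u≮v) (lt-< v<u)) (≡.sym (δ̄-≢ u≢v))

-- The counting lemma runs over ordered deleted pairs, while cards correspond to increasing ones;
-- symmetry of `f` makes the former sum twice the latter.
sum²-δ̄-lt : (f : Fin n → Fin n → ℕ) → (∀ u v → f u v ≡ f v u) →
            sum² (λ u v → δ̄ u v * f u v) ≡ sum² (λ u v → lt u v * f u v) + sum² (λ u v → lt u v * f u v)
sum²-δ̄-lt f f-sym = begin
  sum² (λ u v → δ̄ u v * f u v)
    ≡⟨ (sum²-cong λ u v → trans (cong (_* f u v) (≡.sym (lt+lt u v))) (*-distribʳ-+ (f u v) (lt u v) (lt v u))) ⟩
  sum² (λ u v → lt u v * f u v + lt v u * f u v)
    ≡⟨ sum²-+ (λ u v → lt u v * f u v) (λ u v → lt v u * f u v) ⟩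
  sum² (λ u v → lt u v * f u v) + sum² (λ u v → lt v u * f u v)
    ≡⟨ cong (sum² (λ u v → lt u v * f u v) +_) (trans (∑-comm λ u v → lt v u * f u v) (sum²-cong λ u v → cong (lt u v *_) (f-sym v u))) ⟩
  sum² (λ u v → lt u v * f u v) + sum² (λ u v → lt u v * f u v) ∎
  where open ≡-Reasoning

-- `φ` acts on increasing pairs only. It is extended by the identity to a permutation of all pairs,
-- which is harmless because `lt` vanishes on the added ones.
sum²-lt-reindex : (φ : OrdPair n ↔ OrdPair n) (f g : Fin n → Fin n → ℕ) →
  (∀ p → uncurry f (proj₁ p) ≡ uncurry g (proj₁ (Inverse.to φ p))) →
  sum² (λ u v → lt u v * f u v) ≡ sum² (λ u v → lt u v * g u v)
sum²-lt-reindex {n} φ f g f≡g = trans (sum²-cong pointwise)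
  (sum²-reindex (ext (Inverse.to φ)) (ext (Inverse.from φ))
     (ext-inv (Inverse.to φ) (Inverse.from φ) (Inverse.strictlyInverseˡ φ))
     (ext-inv (Inverse.from φ) (Inverse.to φ) (Inverse.strictlyInverseʳ φ)) (λ u v → lt u v * g u v))
  where
  ext : (OrdPair n → OrdPair n) → Fin n × Fin n → Fin n × Fin n
  ext h (u , v) with u Fin.<? v
  ... | yes u<v = proj₁ (h ((u , v) , u<v))
  ... | no  _   = u , v
  ext-yes : ∀ h p → ext h (proj₁ p) ≡ proj₁ (h p)
  ext-yes h ((u , v) , u<v) with u Fin.<? v
  ... | yes u<v′ = cong (proj₁ ∘ h) (ordPair-≡ refl)
  ... | no  u≮v  = contradiction u<v u≮v
  ext-no : ∀ h {u v} → ¬ u Fin.< v → ext h (u , v) ≡ (u , v)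
  ext-no h {u} {v} u≮v with u Fin.<? v
  ... | yes u<v = contradiction u<v u≮v
  ... | no  _   = refl
  ext-inv : ∀ h k → (∀ p → h (k p) ≡ p) → ∀ p → ext h (ext k p) ≡ p
  ext-inv h k hk (u , v) with u Fin.<? v
  ... | yes u<v = trans (ext-yes h (k ((u , v) , u<v))) (cong proj₁ (hk _))
  ... | no  u≮v = ext-no h u≮v
  pointwise : ∀ u v → lt u v * f u v ≡ uncurry (λ u v → lt u v * g u v) (ext (Inverse.to φ) (u , v))
  pointwise u v with u Fin.<? v
  ... | yes u<v = cong₂ _*_ (trans (lt-< u<v) (≡.sym (lt-< (proj₂ (Inverse.to φ ((u , v) , u<v)))))) (f≡g _)
  ... | no  u≮v = trans (cong (_* f u v) (lt-≮ u≮v)) (cong (_* g u v) (≡.sym (lt-≮ u≮v)))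

-- Consequences of equal decks.

module _ {n : ℕ} (2≤n : 2 ≤ n) (G H : Graph n) (deck : SameDeck (n ∸ 2) G H) where

  private
    module E = Inverse (ordPair↔kSubset 2≤n)
    module D = Inverse (proj₁ deck)

  φ : OrdPair n ↔ OrdPair n
  φ = ↔-trans (ordPair↔kSubset 2≤n) (↔-trans (proj₁ deck) (↔-sym (ordPair↔kSubset 2≤n)))

  deck-cardIso : (p : OrdPair n) → let (u , v) , _ = p; (u′ , v′) , _ = Inverse.to φ p in CardIso G H u v u′ v′
  deck-cardIso p@(_ , u<v) = cardIso (Finₚ.<⇒≢ u<v) (Finₚ.<⇒≢ (proj₂ (Inverse.to φ p)))
    (subst (InducedIso G _ H) (proj₂ (deletedPair 2≤n (D.to (E.to p)))) (proj₂ deck (E.to p)))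

  -- The codegree condition on `H` concerns every pair of `H`, so each such pair must arise as the
  -- deleted pair of a matched card.
  deck-cardIso-onto : {u′ v′ : Fin n} → u′ ≢ v′ → ∃ λ u → ∃ λ v → u ≢ v × CardIso G H u v u′ v′
  deck-cardIso-onto u′≢v′ with ((u , v) , u<v) , S≡ ← deletedPair 2≤n (D.from (deletePair u′≢v′)) =
    u , v , Finₚ.<⇒≢ u<v , cardIso (Finₚ.<⇒≢ u<v) u′≢v′
      (≡.subst₂ (λ S T → InducedIso G S H T) S≡ (cong proj₁ (D.strictlyInverseˡ (deletePair u′≢v′)))
        (proj₂ deck (D.from (deletePair u′≢v′))))

  -- The last hypothesis says that `f` of a surviving triple is visible in the card. Summing over
  -- all cards counts each triple equally often, and this positive multiplicity cancels.
  deck-sum³ : ∀ {b} → n ≡ 5 + b → (f : Graph n → Fin n → Fin n → Fin n → ℕ) →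
    (∀ {u v u′ v′} (c : CardIso G H u v u′ v′) {x y z} →
       x ≢ u → x ≢ v → y ≢ u → y ≢ v → z ≢ u → z ≢ v →
       let open CardIso c in f G x y z ≡ f H (to x) (to y) (to z)) →
    sum³ (λ x y z → distinct x y z * f G x y z) ≡ sum³ (λ x y z → distinct x y z * f H x y z)
  deck-sum³ {b} n≡ f f-local = *-cancelˡ-≡ _ _ (suc b * suc (suc b)) (begin
    suc b * suc (suc b) * sum³ (F G)                     ≡⟨ sum²-sumOff b n≡ (f G) ⟨
    sum² (λ u v → δ̄ u v * sumOff u v (F G))              ≡⟨ sum²-δ̄-lt (λ u v → sumOff u v (F G)) (λ u v → sumOff-swap u v (F G)) ⟩
    sum² (λ u v → lt u v * sumOff u v (F G)) + sum² (λ u v → lt u v * sumOff u v (F G))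
                                                         ≡⟨ cong₂ _+_ reindex reindex ⟩
    sum² (λ u v → lt u v * sumOff u v (F H)) + sum² (λ u v → lt u v * sumOff u v (F H))
                                                         ≡⟨ sum²-δ̄-lt (λ u v → sumOff u v (F H)) (λ u v → sumOff-swap u v (F H)) ⟨
    sum² (λ u v → δ̄ u v * sumOff u v (F H))              ≡⟨ sum²-sumOff b n≡ (f H) ⟩
    suc b * suc (suc b) * sum³ (F H)                     ∎)
    where
    open ≡-Reasoning
    F : Graph n → Fin n → Fin n → Fin n → ℕ
    F K x y z = distinct x y z * f K x y z
    reindex : sum² (λ u v → lt u v * sumOff u v (F G)) ≡ sum² (λ u v → lt u v * sumOff u v (F H))
    reindex = sum²-lt-reindex φ (λ u v → sumOff u v (F G)) (λ u v → sumOff u v (F H))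
      λ p → let c = deck-cardIso p in sumOff-cong c λ {x} {y} {z} p q r s t w →
        cong₂ _*_ (cong₂ _*_ (CardIso.δ̄-to c x y) (cong₂ _*_ (CardIso.δ̄-to c x z) (CardIso.δ̄-to c y z)))
                  (f-local c p q r s t w)

  deck-regular : ∀ {b k} → n ≡ 5 + b → (∀ x → deg G x ≡ k) → ∀ x → deg H x ≡ k
  deck-regular {b} {k} n≡ deg≡k = sum-moments⇒constant (deg H) k
    (trans (≡.sym Σdeg) (sum-cong-≗ deg≡k))
    (trans (≡.sym Σdeg²) (sum-cong-≗ λ x → cong₂ _*_ (deg≡k x) (deg≡k x)))
    where
    open ≡-Reasoning
    Σdeg : sum (deg G) ≡ sum (deg H)
    -- `3 + b` is `n - 2`, the number of choices for the idle third vertex of `edge`.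
    Σdeg = *-cancelˡ-≡ _ _ (3 + b) (begin
      (3 + b) * sum (deg G)                           ≡⟨ sum³-edge G n≡ ⟨
      sum³ (λ x y z → distinct x y z * edge G x y z)  ≡⟨ deck-sum³ n≡ edge (λ c p q r s _ _ → CardIso.a-off c p q r s) ⟩
      sum³ (λ x y z → distinct x y z * edge H x y z)  ≡⟨ sum³-edge H n≡ ⟩
      (3 + b) * sum (deg H)                           ∎)
    Σdeg² : sum (λ x → deg G x * deg G x) ≡ sum (λ x → deg H x * deg H x)
    Σdeg² = begin
      sum (λ x → deg G x * deg G x)                                      ≡⟨ sum³-cherry G ⟨
      sum (deg G) + sum³ (λ x y z → distinct x y z * cherry G x y z)     ≡⟨ cong₂ _+_ Σdeg (deck-sum³ n≡ cherry λ c p q r s t w →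
                                                                              cong₂ _*_ (CardIso.a-off c p q r s) (CardIso.a-off c p q t w)) ⟩
      sum (deg H) + sum³ (λ x y z → distinct x y z * cherry H x y z)     ≡⟨ sum³-cherry H ⟩
      sum (λ x → deg H x * deg H x)                                      ∎

-- Bits recovered from sums and inner products.

bit-injective : ∀ b c → bit b ≡ bit c → b ≡ c
bit-injective true  true  _ = refl
bit-injective false false _ = refl

-- Two bits have product 1 exactly when their sum is 2.
bit-sum⇒bit-product : ∀ b c b′ c′ → bit b + bit c ≡ bit b′ + bit c′ → bit b * bit c ≡ bit b′ * bit c′
bit-sum⇒bit-product true  true  true  true  _ = refl
bit-sum⇒bit-product true  true  true  false ()
bit-sum⇒bit-product true  false true  false _ = refl
bit-sum⇒bit-product true  false false true  _ = refl
bit-sum⇒bit-product false true  true  false _ = refl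
bit-sum⇒bit-product false true  false true  _ = refl
bit-sum⇒bit-product false false false false _ = refl

bit-sum-diagonal : ∀ b b′ c′ → bit b + bit b ≡ bit b′ + bit c′ → b′ ≡ b × c′ ≡ b
bit-sum-diagonal true  true  true  _ = refl , refl
bit-sum-diagonal true  true  false ()
bit-sum-diagonal false false false _ = refl , refl

bit-sum-off-diagonal : ∀ b c b′ c′ → b ≢ c → bit b + bit c ≡ bit b′ + bit c′ →
                       (b′ ≡ b × c′ ≡ c) ⊎ (b′ ≡ c × c′ ≡ b)
bit-sum-off-diagonal true  true  _     _     b≢c _ = contradiction refl b≢c
bit-sum-off-diagonal false false _     _     b≢c _ = contradiction refl b≢c
bit-sum-off-diagonal true  false true  false _   _ = inj₁ (refl , refl)
bit-sum-off-diagonal true  false false true  _   _ = inj₂ (refl , refl)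
bit-sum-off-diagonal false true  true  false _   _ = inj₂ (refl , refl)
bit-sum-off-diagonal false true  false true  _   _ = inj₁ (refl , refl)

-- One of `p` and `q` is 1 and the other 0, so the inner product reads off one coordinate, and the
-- sum then gives the other.
bit-dot-off-diagonal : ∀ p q b c b′ c′ → p ≢ q → bit b + bit c ≡ bit b′ + bit c′ →
  bit p * bit b + bit q * bit c ≡ bit p * bit b′ + bit q * bit c′ → b′ ≡ b × c′ ≡ c
bit-dot-off-diagonal true  true  _ _ _ _ p≢q _ _ = contradiction refl p≢q
bit-dot-off-diagonal false false _ _ _ _ p≢q _ _ = contradiction refl p≢q
bit-dot-off-diagonal true false b c b′ c′ _ sum≡ dot≡
  -- The two cancelled zeros stem from `1 * bit b` and from the product with `bit false`.
  with refl ← bit-injective b b′ (+-cancelʳ-≡ 0 _ _ (+-cancelʳ-≡ 0 _ _ dot≡))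
  = refl , bit-injective c′ c (+-cancelˡ-≡ (bit b) _ _ (≡.sym sum≡))
bit-dot-off-diagonal false true b c b′ c′ _ sum≡ dot≡
  with refl ← bit-injective c c′ (+-cancelʳ-≡ 0 _ _ dot≡)
  = bit-injective b′ b (+-cancelʳ-≡ (bit c) _ _ (≡.sym sum≡)) , refl

-- Totals split into survivors and deleted pair, and the exchange of the deleted pair.

sum-split : {u v : Fin n} → u ≢ v → (f : Fin n → ℕ) →
            f u + f v + sum (λ x → off u v x * f x) ≡ sum f
sum-split {n} {u} {v} u≢v f = begin
  f u + f v + sum (λ x → off u v x * f x)                         ≡⟨ +-assoc (f u) _ _ ⟩
  f u + (f v + sum (λ x → off u v x * f x))                       ≡⟨ cong (f u +_) (cong₂ _+_ head≡ (sum-cong-≗ tail≡)) ⟩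
  f u + (δ̄ u v * f v + sum (λ x → δ̄ v x * (δ̄ u x * f x)))       ≡⟨ cong (f u +_) (sum-δ̄ v (λ x → δ̄ u x * f x)) ⟩
  f u + sum (λ x → δ̄ u x * f x)                                   ≡⟨ sum-δ̄ u f ⟩
  sum f                                                           ∎
  where
  open ≡-Reasoning
  head≡ : f v ≡ δ̄ u v * f v
  head≡ = trans (≡.sym (*-identityˡ (f v))) (cong (_* f v) (≡.sym (δ̄-≢ u≢v)))
  tail≡ : ∀ x → off u v x * f x ≡ δ̄ v x * (δ̄ u x * f x)
  tail≡ x = trans (cong (_* f x) (trans (*-comm (δ̄ x u) _) (cong₂ _*_ (δ̄-sym x v) (δ̄-sym x u)))) (*-assoc (δ̄ v x) _ _)

transpose-fst : (i j : Fin n) → Inverse.to (transpose i j) i ≡ j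
transpose-fst i j rewrite dec-true (i ≟ i) refl = refl

transpose-snd : {i j : Fin n} → i ≢ j → Inverse.to (transpose i j) j ≡ i
transpose-snd {i = i} {j} i≢j rewrite dec-false (j ≟ i) (i≢j ∘ ≡.sym) | dec-true (j ≟ j) refl = refl

transpose-off : {i j k : Fin n} → k ≢ i → k ≢ j → Inverse.to (transpose i j) k ≡ k
transpose-off {i = i} {j} {k} k≢i k≢j rewrite dec-false (k ≟ i) k≢i | dec-false (k ≟ j) k≢j = refl

module _ {G H : Graph n} {u v u′ v′ : Fin n} (u≢v : u ≢ v) (c : CardIso G H u v u′ v′) where
  open CardIso c

  ends-≢ : u′ ≢ v′
  ends-≢ e = u≢v (to-injective (trans π-u (trans e (≡.sym π-v))))

  swap-off : ∀ {x} → x ≢ u → x ≢ v → Inverse.to (transpose u′ v′) (to x) ≡ to x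
  swap-off x≢u x≢v = transpose-off (λ e → x≢u (to-injective (trans e (≡.sym π-u))))
                                   (λ e → x≢v (to-injective (trans e (≡.sym π-v))))

  -- A card does not constrain which deleted vertex goes to which, so the two images may be
  -- exchanged by a transposition that fixes the images of all survivors.
  swap : CardIso G H u v v′ u′
  swap = record
    { π       = ↔-trans π (transpose u′ v′)
    ; π-u     = trans (cong (Inverse.to (transpose u′ v′)) π-u) (transpose-fst u′ v′)
    ; π-v     = trans (cong (Inverse.to (transpose u′ v′)) π-v) (transpose-snd ends-≢)
    ; adj-off = λ p q r s → trans (cong₂ (adj H) (swap-off p q) (swap-off r s)) (adj-off p q r s)
    }

-- What a card reveals about its deleted pair.

module _ {G H : Graph n} {u v u′ v′ : Fin n} (u≢v : u ≢ v) (c : CardIso G H u v u′ v′) where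
  open CardIso c

  module _ (f g : Fin n → ℕ) (f≡g : ∀ {x} → x ≢ u → x ≢ v → f x ≡ g (to x)) where

    private
      u′≢v′ : u′ ≢ v′
      u′≢v′ = ends-≢ u≢v c

      off≡ : sum (λ x → off u v x * f x) ≡ sum (λ x → off u′ v′ x * g x)
      off≡ = trans
        (sum-cong-≗ λ x → trans (off-guard u v x f≡g) (cong (_* g (to x)) (off-to x)))
        (≡.sym (sum-permute (λ x → off u′ v′ x * g x) π))

    -- Survivors contribute equally to both totals, so the totals agree exactly when the shares of
    -- the deleted pairs do. This direction extracts information on the deleted pair; the converse
    -- rebuilds codegrees.
    sum≡⇒ends≡ : sum f ≡ sum g → f u + f v ≡ g u′ + g v′
    sum≡⇒ends≡ Σ≡ = +-cancelʳ-≡ (sum (λ x → off u v x * f x)) _ _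
      (trans (sum-split u≢v f) (trans Σ≡ (trans (≡.sym (sum-split u′≢v′ g)) (cong (g u′ + g v′ +_) (≡.sym off≡)))))

    ends≡⇒sum≡ : f u + f v ≡ g u′ + g v′ → sum f ≡ sum g
    ends≡⇒sum≡ ends≡ = trans (≡.sym (sum-split u≢v f)) (trans (cong₂ _+_ ends≡ off≡) (sum-split u′≢v′ g))

  module _ {k : ℕ} (G-regular : ∀ x → deg G x ≡ k) (H-regular : ∀ x → deg H x ≡ k) where

    a-ends : ∀ {x} → x ≢ u → x ≢ v → a G x u + a G x v ≡ a H (to x) u′ + a H (to x) v′
    a-ends {x} x≢u x≢v = sum≡⇒ends≡ (a G x) (a H (to x)) (a-off x≢u x≢v)
      (trans (G-regular x) (≡.sym (H-regular (to x))))

    -- The degrees of the deleted pair add up to `k + k` in each graph, and the survivors account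
    -- for equal shares by `a-ends`. What is left is twice the adjacency bit of the deleted pair.
    adj-ends : adj H u′ v′ ≡ adj G u v
    adj-ends = proj₁ (bit-sum-diagonal (adj G u v) (adj H u′ v′) (adj H u′ v′)
      (trans (≡.sym (ends G u v)) (trans (sum≡⇒ends≡ (to-ends G u v) (to-ends H u′ v′) a-ends
        (trans (total G G-regular u v) (≡.sym (total H H-regular u′ v′)))) (ends H u′ v′))))
      where
      to-ends : Graph n → Fin n → Fin n → Fin n → ℕ
      to-ends K p q x = a K x p + a K x q
      ends : ∀ K p q → to-ends K p q p + to-ends K p q q ≡ a K p q + a K p q
      ends K p q = cong₂ _+_ (cong (_+ a K p q) (a-irref K p))
        (trans (cong₂ _+_ (a-sym K q p) (a-irref K q)) (+-identityʳ _))
      total : ∀ K → (∀ x → deg K x ≡ k) → ∀ p q → sum (to-ends K p q) ≡ k + k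
      total K regular p q = trans (∑-distrib-+ (λ x → a K x p) (λ x → a K x q))
        (cong₂ _+_ (trans (sum-cong-≗ λ x → a-sym K x p) (regular p)) (trans (sum-cong-≗ λ x → a-sym K x q) (regular q)))

    -- By `a-ends` each survivor sees equally many deleted vertices in both graphs, and it is a
    -- common neighbour exactly when it sees both. The deleted vertices themselves contribute
    -- nothing, as there are no loops.
    codeg-ends : codeg G u v ≡ codeg H u′ v′
    codeg-ends = ends≡⇒sum≡ (λ x → a G u x * a G v x) (λ x → a H u′ x * a H v′ x) common
      (trans (ends G u v) (≡.sym (ends H u′ v′)))
      where
      common : ∀ {x} → x ≢ u → x ≢ v → a G u x * a G v x ≡ a H u′ (to x) * a H v′ (to x)
      common {x} x≢u x≢v = trans (cong₂ _*_ (a-sym G u x) (a-sym G v x))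
        (trans (bit-sum⇒bit-product (adj G x u) (adj G x v) (adj H (to x) u′) (adj H (to x) v′) (a-ends x≢u x≢v))
               (≡.sym (cong₂ _*_ (a-sym H u′ (to x)) (a-sym H v′ (to x)))))
      ends : ∀ K p q → a K p p * a K q p + a K p q * a K q q ≡ 0
      ends K p q = cong₂ _+_ (cong (_* a K q p) (a-irref K p))
        (trans (cong (a K p q *_) (a-irref K q)) (*-zeroʳ (a K p q)))

  -- `π` already preserves adjacency between survivors, so only pairs that meet `u` or `v` remain.
  -- The isomorphism from `H` to `G` is the inverse of `π`.
  glue : adj H u′ v′ ≡ adj G u v →
    (∀ {x} → x ≢ u → x ≢ v → adj H (to x) u′ ≡ adj G x u × adj H (to x) v′ ≡ adj G x v) → H ≅ G
  glue adj-uv adj-ends = ↔-sym π , λ x y → trans (≡.sym (preserved (Inverse.from π x) (Inverse.from π y)))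
    (cong₂ (adj H) (Inverse.strictlyInverseˡ π x) (Inverse.strictlyInverseˡ π y))
    where
    -- The pair `p , p′` stands for `u , u′` or `v , v′`, so one case analysis treats both ends.
    to-end : ∀ x {p p′} → p ≡ u × p′ ≡ u′ ⊎ p ≡ v × p′ ≡ v′ → adj H (to x) p′ ≡ adj G x p
    to-end x e with x ≟ u | x ≟ v | e
    ... | yes refl | _        | inj₁ (refl , refl) rewrite π-u = trans (irref H u′) (≡.sym (irref G u))
    ... | yes refl | _        | inj₂ (refl , refl) rewrite π-u = adj-uv
    ... | no _     | yes refl | inj₁ (refl , refl) rewrite π-v = trans (sym H v′ u′) (trans adj-uv (sym G u v))
    ... | no _     | yes refl | inj₂ (refl , refl) rewrite π-v = trans (irref H v′) (≡.sym (irref G v))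
    ... | no x≢u   | no x≢v   | inj₁ (refl , refl) = proj₁ (adj-ends x≢u x≢v)
    ... | no x≢u   | no x≢v   | inj₂ (refl , refl) = proj₂ (adj-ends x≢u x≢v)
    preserved : ∀ x y → adj H (to x) (to y) ≡ adj G x y
    preserved x y with y ≟ u | y ≟ v | x ≟ u | x ≟ v
    ... | yes refl | _        | _        | _        = to-end x (inj₁ (refl , π-u))
    ... | no _     | yes refl | _        | _        = to-end x (inj₂ (refl , π-v))
    ... | no _     | no _     | yes refl | _        = trans (sym H _ _) (trans (to-end y (inj₁ (refl , π-u))) (sym G y x))
    ... | no _     | no _     | no _     | yes refl = trans (sym H _ _) (trans (to-end y (inj₂ (refl , π-v))) (sym G y x))
    ... | no y≢u   | no y≢v   | no x≢u   | no x≢v   = adj-off x≢u x≢v y≢u y≢v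

-- Reconstruction from a single card.

-- Both conditions on common neighbours in one formula in the adjacency bit, so that equal adjacency
-- directly yields equal codegrees.
CodegreeDeterminedBy : ℕ → ℕ → Graph n → Set
CodegreeDeterminedBy l m G = ∀ {u v} → u ≢ v → codeg G u v ≡ (if adj G u v then l else m)

-- The sums from `a-ends` leave open only which of `u` and `v` is seen. A survivor `z` that
-- distinguishes them, if there is one, settles this for all survivors at once.
cardIso⇒≅ : ∀ {k l m} {G H : Graph n} {u v u′ v′} → u ≢ v → CardIso G H u v u′ v′ →
  (∀ x → deg G x ≡ k) → (∀ x → deg H x ≡ k) →
  CodegreeDeterminedBy l m G → CodegreeDeterminedBy l m H → H ≅ G
cardIso⇒≅ {n} {l = l} {m} {G} {H} {u} {v} {u′} {v′} u≢v c G-regular H-regular G-codeg H-codeg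
  with Finₚ.any? (λ x → ¬? (x ≟ u) ×-dec ¬? (x ≟ v) ×-dec ¬? (adj G x u ≟ᵇ adj G x v))
-- Every survivor sees both or neither of `u` and `v`, so the sum alone determines its two bits.
... | no none = glue u≢v c adj-uv balanced
  where
  open CardIso c
  adj-uv = adj-ends u≢v c G-regular H-regular
  balanced : ∀ {x} → x ≢ u → x ≢ v → adj H (to x) u′ ≡ adj G x u × adj H (to x) v′ ≡ adj G x v
  balanced {x} x≢u x≢v with adj G x u ≟ᵇ adj G x v
  ... | no  ≢ = contradiction (x , x≢u , x≢v , ≢) none
  ... | yes e =
    let p , q = bit-sum-diagonal (adj G x u) (adj H (to x) u′) (adj H (to x) v′)
                  (trans (cong (λ b → a G x u + bit b) e) (a-ends u≢v c G-regular H-regular x≢u x≢v))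
    in p , trans q e
... | yes (z , z≢u , z≢v , z≢) = aligned
    (bit-sum-off-diagonal (adj G z u) (adj G z v) (adj H (CardIso.to c z) u′) (adj H (CardIso.to c z) v′) z≢
      (a-ends u≢v c G-regular H-regular z≢u z≢v))
  where
  straight : ∀ {u′ v′} (c : CardIso G H u v u′ v′) → let open CardIso c in
    adj H (to z) u′ ≡ adj G z u → adj H (to z) v′ ≡ adj G z v → H ≅ G
  straight {u′} {v′} c zu zv = glue u≢v c (adj-ends u≢v c G-regular H-regular) ends
    where
    open CardIso c
    dot : ∀ {x} → x ≢ u → x ≢ v → z ≢ x →
      a G z u * a G x u + a G z v * a G x v ≡ a G z u * a H (to x) u′ + a G z v * a H (to x) v′
    dot {x} x≢u x≢v z≢x = trans
      -- The codegree of `z` and `x` is the same in both graphs, since their adjacency is preserved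
      -- and the parameters agree. Survivors contribute equally to it, so the parts through the
      -- deleted pairs agree too.
      (sum≡⇒ends≡ u≢v c (λ w → a G z w * a G x w) (λ w → a H (to z) w * a H (to x) w)
        (λ w≢u w≢v → cong₂ _*_ (a-off z≢u z≢v w≢u w≢v) (a-off x≢u x≢v w≢u w≢v))
        (trans (G-codeg z≢x) (trans (cong (if_then l else m) (≡.sym (adj-off z≢u z≢v x≢u x≢v)))
          (≡.sym (H-codeg (z≢x ∘ to-injective))))))
      (cong₂ (λ p q → bit p * a H (to x) u′ + bit q * a H (to x) v′) zu zv)
    ends : ∀ {x} → x ≢ u → x ≢ v → adj H (to x) u′ ≡ adj G x u × adj H (to x) v′ ≡ adj G x v
    ends {x} x≢u x≢v with z ≟ x
    ... | yes refl = zu , zv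
    ... | no z≢x   = bit-dot-off-diagonal (adj G z u) (adj G z v) (adj G x u) (adj G x v) _ _ z≢
                       (a-ends u≢v c G-regular H-regular x≢u x≢v) (dot x≢u x≢v z≢x)
  aligned : let z′ = CardIso.to c z in
    (adj H z′ u′ ≡ adj G z u × adj H z′ v′ ≡ adj G z v) ⊎ (adj H z′ u′ ≡ adj G z v × adj H z′ v′ ≡ adj G z u) → H ≅ G
  aligned (inj₁ (zu , zv)) = straight c zu zv
  -- The view of `z` is crossed, so the images of `u` and `v` are exchanged first; the image of `z`
  -- is unaffected.
  aligned (inj₂ (zu , zv)) = straight (swap u≢v c)
    (trans (cong (λ w → adj H w v′) swap-z) zv) (trans (cong (λ w → adj H w u′) swap-z) zu)
    where
    swap-z : CardIso.to (swap u≢v c) z ≡ CardIso.to c z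
    swap-z = swap-off u≢v c z≢u z≢v

theorem2 : ∀ (n : ℕ) → 6 ≤ n → (G : Graph n) → StronglyRegular G →
    Reconstructible 2 G
theorem2 (suc (suc (suc (suc (suc b))))) (s≤s (s≤s (s≤s (s≤s (s≤s _))))) G (k , l , m , N≡k , adj⇒l , nonadj⇒m) H deck =
  -- Any card would serve here; the one missing the first two vertices is taken.
  cardIso⇒≅ {u = zero} {suc zero} (λ ()) (deck-cardIso 2≤n G H deck ((zero , suc zero) , s≤s z≤n)) G-regular H-regular G-codeg H-codeg
  where
  2≤n : 2 ≤ 5 + b
  2≤n = s≤s (s≤s z≤n)
  G-regular : ∀ x → deg G x ≡ k
  G-regular x = trans (≡.sym (∣N∣ G x)) (N≡k x)
  H-regular : ∀ x → deg H x ≡ k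
  H-regular = deck-regular 2≤n G H deck refl G-regular
  G-codeg : CodegreeDeterminedBy l m G
  G-codeg {u} {v} u≢v with adj G u v in eq
  ... | true  = trans (≡.sym (∣N∩N∣ G u v)) (adj⇒l u v eq)
  ... | false = trans (≡.sym (∣N∩N∣ G u v)) (nonadj⇒m u v u≢v eq)
  H-codeg : CodegreeDeterminedBy l m H
  -- Each pair of `H` is the deleted pair of a card matched with one of `G`, from which its
  -- adjacency and codegree are inherited.
  H-codeg u′≢v′ with u , v , u≢v , c ← deck-cardIso-onto 2≤n G H deck u′≢v′ =
    trans (≡.sym (codeg-ends u≢v c G-regular H-regular))
      (trans (G-codeg u≢v) (cong (if_then l else m) (≡.sym (adj-ends u≢v c G-regular H-regular))))
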